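{- Let $r\geq 2$, $k\ge 2$, $1\leq \ell\leq k-1$, and set $q := \ell-1+\lfloor\frac{k}{k-\ell}\rfloor(k-\ell)$ and $c_0:=c_0(r,k,\ell)=2k^2\,\hat{R}_r(P_{q}^{(k-1,\ell-1)})$. For all $n\geq c_0$, \[ \hat{R}_r(P_{n}^{(k,\ell)})\geq \frac1{k}\, \hat{R}_r(P_{q}^{(k-1,\ell-1)})\, R_r(P_{n-c_0}^{(k,\ell)}). \] In particular, if $\ell=k-1$, then $\hat{R}_r(P^{(k)}_{n})\geq \frac1{k}\, \hat{R}_r(P_{2k-2}^{(k-1)})\, R_r(P_{n-c_0}^{(k)})$.
   Context: A $k$-graph is a $k$-uniform hypergraph. For hypergraphs $G,H$ and an integer $r\ge 1$, $G\to_r H$ means that every $r$-coloring of the edges of $G$ contains a monochromatic copy of $H$. For a $k$-graph $H$, the $r$-color size-Ramsey number $\hat R_r(H)$ is the minimum number of edges of a $k$-graph $G$ with $G\to_r H$, and the $r$-color Ramsey number $R_r(H)$ is the minimum number of vertices of a $k$-graph $G$ with $G\to_r H$. For $0\le \ell\le k-1$ and $m\ge 1$, the $k$-uniform $\ell$-overlapping path (or $(k,\ell)$-path) with $m$ edges is the $k$-graph with vertex set $\{v_1,\dots,v_{k+(m-1)(k-\ell)}\}$ and edges $\{v_{(i-1)(k-\ell)+1},\dots,v_{(i-1)(k-\ell)+k}\}$ for $i\in[m]$; $P_n^{(k,\ell)}$ denotes the $(k,\ell)$-path with $n$ vertices (so it has $(n-\ell)/(k-\ell)$ edges). For $\ell=0$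 this is a $k$-uniform matching. $P_n^{(k)}:=P_n^{(k,k-1)}$ is the $k$-uniform tight path on $n$ vertices. -}

module Defs where

open import Data.Nat using (ℕ; zero; suc; _+_; _*_; _∸_; _≤_; _<_; _≤ᵇ_; _<ᵇ_)
open import Data.Nat.DivMod using (_/_)
open import Data.Bool using (_∧_)
open import Data.Fin using (Fin; toℕ)
open import Data.Fin.Subset using (Subset; _∈_; ∣_∣)
open import Data.Vec using (tabulate)
open import Data.Product using (Σ; ∃; _×_)
open import Function.Definitions using (Injective)
open import Relation.Binary.PropositionalEquality using (_≡_)

record Hypergraph : Set where
  field
    nV   : ℕ
    nE   : ℕ
    edge : Fin nE → Subset nV
open Hypergraph public

-- H is a k-graph: every edge has exactly k vertices and edges are distinct
-- (so nE is the number of edges of the set system).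
IsKGraph : ℕ → Hypergraph → Set
IsKGraph k H = ((i : Fin (nE H)) → ∣ edge H i ∣ ≡ k)
             × Injective _≡_ _≡_ (edge H)

MapsOnto : {a b : ℕ} → (Fin a → Fin b) → Subset a → Subset b → Set
MapsOnto {a} {b} f e e' =
  (y : Fin b) → ((y ∈ e') → Σ (Fin a) λ x → (x ∈ e) × (f x ≡ y))
              × ((Σ (Fin a) λ x → (x ∈ e) × (f x ≡ y)) → y ∈ e')

Arrows : Hypergraph → ℕ → Hypergraph → Set
Arrows G r H =
  (col : Fin (nE G) → Fin r) →
  Σ (Fin r) λ c →
  Σ (Fin (nV H) → Fin (nV G)) λ f →
    Injective _≡_ _≡_ f ×
    ((i : Fin (nE H)) → Σ (Fin (nE G)) λ j →
        (col j ≡ c) × MapsOnto f (edge H i) (edge G j))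

IsSizeRamseyNumber : ℕ → ℕ → Hypergraph → ℕ → Set
IsSizeRamseyNumber r k H s =
  (Σ Hypergraph λ G → IsKGraph k G × Arrows G r H × (nE G ≡ s))
  × ((G : Hypergraph) → IsKGraph k G → Arrows G r H → s ≤ nE G)

IsRamseyNumber : ℕ → ℕ → Hypergraph → ℕ → Set
IsRamseyNumber r k H N =
  (Σ Hypergraph λ G → IsKGraph k G × Arrows G r H × (nV G ≡ N))
  × ((G : Hypergraph) → IsKGraph k G → Arrows G r H → N ≤ nV G)

pathEdges : (k ℓ m : ℕ) → Hypergraph
pathEdges k ℓ m = record
  { nV   = ℓ + m * (k ∸ ℓ)
  ; nE   = m
  ; edge = λ i → tabulate λ v →
      (toℕ i * (k ∸ ℓ) ≤ᵇ toℕ v) ∧ (toℕ v <ᵇ toℕ i * (k ∸ ℓ) + k)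
  }

-- number of edges ⌊(n - ℓ)/(k - ℓ)⌋ (truncated subtraction; k - ℓ = 0 never used)
numEdges : (k ℓ n : ℕ) → ℕ
numEdges k ℓ n with k ∸ ℓ
... | zero  = 0
... | suc d = (n ∸ ℓ) / suc d

-- P_n^{(k,ℓ)}: the (k,ℓ)-path on n vertices; for n not of the form
-- ℓ + m(k-ℓ) this is the longest (k,ℓ)-path with at most n vertices.
P : (n k ℓ : ℕ) → Hypergraph
P n k ℓ = pathEdges k ℓ (numEdges k ℓ n)

qVal : (k ℓ : ℕ) → ℕ
qVal k ℓ with k ∸ ℓ
... | zero  = 0
... | suc d = (ℓ ∸ 1) + (k / suc d) * suc d

{-# OPTIONS --safe #-}
module Submission where

-- Let G →_r P_n, and let L be the set of vertices of degree at least s₀; counting incidences gives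
-- |L| s₀ ≤ k e(G), so if the bound fails then |L| < N and G[L] has a colouring without a monochromatic
-- P_{n-c₀}, while the link of each vertex outside L has a colouring without a monochromatic P_q.
-- Colour the low vertices properly with s₀ (k-1) classes χ, two of them being adjacent if they share an
-- edge. An edge inside L keeps its colour from G[L]; any other edge is coloured as in the link of
-- its low vertex of largest χ. On a monochromatic P_n, a low vertex away from the ends has a nearby low
-- vertex of larger χ, for otherwise its link would contain a monochromatic P_q. Such chains are short,
-- so low vertices occur only near the ends, and the middle of the path is a P_{n-c₀} inside L.
-- The existence of the colourings is used under double negation, since the conclusion is decidable.

open import Defs
open import Data.Nat using (ℕ; zero; suc; _+_; _*_; _∸_; _≤_; _<_; z≤n; s≤s; NonZero; >-nonZero)
open import Data.Nat.Divisibility using (_∣_)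
open import Data.Nat.Properties
open import Data.Nat.Tactic.RingSolver using (solve-∀)
open import Data.Nat.DivMod using (_/_; m≡m%n+[m/n]*n; m%n<n; m/n*n≤m; m/n*n≡m; m*n/n≡m; /-monoˡ-≤)
open import Data.Bool using (true; false; if_then_else_)
open import Data.Bool.Properties using (T-≡; T-∧)
open import Data.Fin using (Fin; zero; suc; toℕ; fromℕ<; combine; remQuot; cast)
import Data.Fin.Properties as Fin
open import Data.Fin.Subset using (Subset; _∈_; _∉_; _⊆_; ∣_∣; ⊤; _-_)
open import Data.Fin.Subset.Properties using (_∈?_; ⊆-antisym; drop-∷-⊆; p─⊥≡p; p─q⊆p; x∈p∧x≢y⇒x∈p-y; _⊆?_; ∈⊤)
open import Data.Vec using (_∷_; []; lookup; tabulate; here; there)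
open import Data.Vec.Properties using (lookup∘tabulate; []=⇒lookup; lookup⇒[]=)
import Data.Vec.Functional as F
open import Data.Empty using (⊥-elim)
open import Data.Product using (Σ; ∃; _×_; _,_; proj₁; proj₂)
open import Data.Sum as Sum using (_⊎_; inj₁; inj₂)
open import Function using (_∘_; case_of_)
open import Function.Bundles using (Equivalence)
open import Function.Definitions using (Injective)
open import Relation.Nullary using (¬_; Dec; yes; no; contradiction; does)
open import Relation.Nullary.Decidable using (_×-dec_; _→-dec_; ¬?; decidable-stable; dec-true)
open import Relation.Nullary.Negation using (¬¬-map)
open import Relation.Unary using (Decidable)
open import Relation.Binary.Definitions using (tri<; tri≈; tri>)
open import Relation.Binary.PropositionalEquality
open import Algebra.Properties.CommutativeMonoid.Sum +-0-commutativeMonoid using (sum; ∑-comm; sum-cong-≗)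

private
  variable
    a b n m r : ℕ

-- Subsets of `Fin n`: enumeration, preimages, separation.

enum : (p : Subset n) → Fin ∣ p ∣ → Fin n
enum (true ∷ p) zero = zero
enum (true ∷ p) (suc i) = suc (enum p i)
enum (false ∷ p) i = suc (enum p i)

enum-∈ : (p : Subset n) (i : Fin ∣ p ∣) → enum p i ∈ p
enum-∈ (true ∷ p) zero = here
enum-∈ (true ∷ p) (suc i) = there (enum-∈ p i)
enum-∈ (false ∷ p) i = there (enum-∈ p i)

enum-injective : (p : Subset n) → Injective _≡_ _≡_ (enum p)
enum-injective (true ∷ p) {zero} {zero} eq = refl
enum-injective (true ∷ p) {suc i} {suc j} eq = cong suc (enum-injective p (Fin.suc-injective eq))
enum-injective (false ∷ p) eq = enum-injective p (Fin.suc-injective eq)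

enum-surjective : (p : Subset n) {x : Fin n} → x ∈ p → Σ (Fin ∣ p ∣) λ i → enum p i ≡ x
enum-surjective (true ∷ p) here = zero , refl
enum-surjective (true ∷ p) (there x∈p) = let i , eq = enum-surjective p x∈p in suc i , cong suc eq
enum-surjective (false ∷ p) (there x∈p) = let i , eq = enum-surjective p x∈p in i , cong suc eq

preimage : (Fin b → Fin a) → Subset a → Subset b
preimage f p = tabulate (lookup p ∘ f)

∈-preimage⁺ : (f : Fin b → Fin a) {p : Subset a} {x : Fin b} → f x ∈ p → x ∈ preimage f p
∈-preimage⁺ f {p} {x} fx∈p = lookup⇒[]= x _ (trans (lookup∘tabulate (lookup p ∘ f) x) ([]=⇒lookup fx∈p))

∈-preimage⁻ : (f : Fin b → Fin a) {p : Subset a} {x : Fin b} → x ∈ preimage f p → f x ∈ p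
∈-preimage⁻ f {p} {x} x∈ =
  lookup⇒[]= (f x) p (trans (sym (lookup∘tabulate (lookup p ∘ f) x)) ([]=⇒lookup x∈))

∣preimage-enum∣ : (W p : Subset n) → p ⊆ W → ∣ preimage (enum W) p ∣ ≡ ∣ p ∣
∣preimage-enum∣ [] [] _ = refl
∣preimage-enum∣ (true ∷ W) (true ∷ p) p⊆W = cong suc (∣preimage-enum∣ W p (drop-∷-⊆ p⊆W))
∣preimage-enum∣ (true ∷ W) (false ∷ p) p⊆W = ∣preimage-enum∣ W p (drop-∷-⊆ p⊆W)
∣preimage-enum∣ (false ∷ W) (true ∷ p) p⊆W with () ← p⊆W here
∣preimage-enum∣ (false ∷ W) (false ∷ p) p⊆W = ∣preimage-enum∣ W p (drop-∷-⊆ p⊆W)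

∣p∣≡1+∣p-x∣ : (p : Subset n) {x : Fin n} → x ∈ p → ∣ p ∣ ≡ suc ∣ p - x ∣
∣p∣≡1+∣p-x∣ (true ∷ p) here = cong (suc ∘ ∣_∣) (sym (p─⊥≡p p))
∣p∣≡1+∣p-x∣ (true ∷ p) (there x∈p) = cong suc (∣p∣≡1+∣p-x∣ p x∈p)
∣p∣≡1+∣p-x∣ (false ∷ p) (there x∈p) = ∣p∣≡1+∣p-x∣ p x∈p

separate : {P : Fin n → Set} → Decidable P → Subset n
separate P? = tabulate (does ∘ P?)

∈-separate⁺ : {P : Fin n → Set} (P? : Decidable P) {x : Fin n} → P x → x ∈ separate P?
∈-separate⁺ P? {x} px = lookup⇒[]= x _ (trans (lookup∘tabulate _ x) (dec-true (P? x) px))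

∈-separate⁻ : {P : Fin n → Set} (P? : Decidable P) {x : Fin n} → x ∈ separate P? → P x
∈-separate⁻ P? {x} x∈ with P? x | trans (sym (lookup∘tabulate (does ∘ P?) x)) ([]=⇒lookup x∈)
... | yes px | _ = px
... | no _ | ()

-- Double negation over finite ranges.

-- Against a goal of falsity, finitely many double negations can be opened one after another.
¬¬-∀-Fin : {P : Fin n → Set} → (∀ i → ¬ ¬ P i) → ¬ ¬ (∀ i → P i)
¬¬-∀-Fin {zero} h k = k λ ()
¬¬-∀-Fin {suc n} h k =
  h zero λ p₀ → ¬¬-∀-Fin (h ∘ suc) λ ps → k λ { zero → p₀ ; (suc i) → ps i }

-- Functions Fin m → Fin r are finite in number only up to pointwise equality, hence the extensionality hypothesis.
¬¬-∀-colouring : {X : (Fin m → Fin r) → Set} → (∀ {f g} → f ≗ g → X f → X g) →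
  (∀ f → ¬ ¬ X f) → ¬ ¬ (∀ f → X f)
¬¬-∀-colouring {zero} ext h k = h (λ ()) λ x → k λ f → ext (λ ()) x
¬¬-∀-colouring {suc m} {X = X} ext h k =
  ¬¬-∀-Fin (λ c → ¬¬-∀-colouring {X = λ f → X (c F.∷ f)}
              (λ f≗g → ext λ { zero → refl ; (suc i) → f≗g i })
              (λ f → h (c F.∷ f)))
    λ all → k λ f → ext (λ { zero → refl ; (suc i) → refl }) (all (f zero) (f ∘ suc))

-- Induced hypergraphs and colourings avoiding a monochromatic copy.

extend : (S : Subset a) (cs : Fin ∣ S ∣ → Fin r) → 0 < r →
  Σ (Fin a → Fin r) λ col → ∀ i → col (enum S i) ≡ cs i
extend {a} {r} S cs 0<r = col , eq
  where
  pick : (j : Fin a) → Dec (Σ (Fin ∣ S ∣) λ i → enum S i ≡ j) → Fin r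
  pick j (yes (i , _)) = cs i
  -- Indices outside `S` get the default colour 0, which exists because r is positive.
  pick j (no _) = fromℕ< 0<r
  preimage? : (j : Fin a) → Dec (Σ (Fin ∣ S ∣) λ i → enum S i ≡ j)
  preimage? j = Fin.any? (λ i → enum S i Fin.≟ j)
  col : Fin a → Fin r
  col j = pick j (preimage? j)
  eq : ∀ i → col (enum S i) ≡ cs i
  eq i with preimage? (enum S i)
  ... | yes (i' , e) = cong cs (enum-injective S e)
  ... | no ¬∃ = contradiction (i , refl) ¬∃

-- `E` is an arbitrary family of sets, so that the same construction yields both G[L] and, with a
-- vertex removed from each edge, the link of that vertex.
induced : (Fin a → Subset b) → Subset b → Subset a → Hypergraph
induced E W S = record
  { nV = ∣ W ∣ ; nE = ∣ S ∣ ; edge = λ i → preimage (enum W) (E (enum S i)) }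

induced-IsKGraph : {E : Fin a → Subset b} {W : Subset b} {S : Subset a} {k : ℕ} →
  (∀ {j} → j ∈ S → E j ⊆ W) → (∀ {j} → j ∈ S → ∣ E j ∣ ≡ k) →
  (∀ {i j} → i ∈ S → j ∈ S → E i ≡ E j → i ≡ j) → IsKGraph k (induced E W S)
induced-IsKGraph {E = E} {W} {S} E⊆W size inj = sizes , injective
  where
  sizes : ∀ i → ∣ preimage (enum W) (E (enum S i)) ∣ ≡ _
  sizes i = trans (∣preimage-enum∣ W _ (E⊆W (enum-∈ S i))) (size (enum-∈ S i))
  incl : ∀ i j → preimage (enum W) (E (enum S i)) ≡ preimage (enum W) (E (enum S j)) →
    E (enum S i) ⊆ E (enum S j)
  incl i j eq x∈ with enum-surjective W (E⊆W (enum-∈ S i) x∈)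
  ... | y , refl = ∈-preimage⁻ (enum W) (subst (y ∈_) eq (∈-preimage⁺ (enum W) x∈))
  injective : Injective _≡_ _≡_ (edge (induced E W S))
  injective {i} {j} eq = enum-injective S
    (inj (enum-∈ S i) (enum-∈ S j) (⊆-antisym (incl i j eq) (incl j i (sym eq))))

-- The conclusion of `Arrows` for one fixed colouring.
Monochromatic : (G : Hypergraph) → (Fin (nE G) → Fin r) → Hypergraph → Set
Monochromatic {r} G col H =
  Σ (Fin r) λ c →
  Σ (Fin (nV H) → Fin (nV G)) λ f →
    Injective _≡_ _≡_ f ×
    ((i : Fin (nE H)) → Σ (Fin (nE G)) λ j → (col j ≡ c) × MapsOnto f (edge H i) (edge G j))

-- A monochromatic copy inside `induced E W S`, expressed with the ambient vertices and edges.
-- Colourings of different induced hypergraphs can then be combined without renumbering.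
MonoCopy : (Fin a → Subset b) → Subset b → Subset a → (Fin a → Fin r) → Hypergraph → Set
MonoCopy {a} {b} {r} E W S col H =
  Σ (Fin r) λ c →
  Σ (Fin (nV H) → Fin b) λ f →
    Injective _≡_ _≡_ f × (∀ x → f x ∈ W) ×
    ((i : Fin (nE H)) → Σ (Fin a) λ j → j ∈ S × (col j ≡ c) × MapsOnto f (edge H i) (E j))

-- If no ambient colouring avoids `H`, then each colouring of `S`, extended arbitrarily, has a copy
-- up to double negation. As there are finitely many colourings, the double negation moves outside
-- and contradicts `¬arrows`.
¬Arrows⇒avoiding : (E : Fin a → Subset b) (W : Subset b) (S : Subset a) (H : Hypergraph) → 0 < r →
  ¬ Arrows (induced E W S) r H → ¬ ¬ (Σ (Fin a → Fin r) λ col → ¬ MonoCopy E W S col H)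
¬Arrows⇒avoiding {r = r} E W S H 0<r ¬arrows ¬avoiding =
  ¬¬-∀-colouring {X = λ cs → Monochromatic (induced E W S) cs H}
    (λ f≗g (c , f , inj , copies) →
      c , f , inj , λ i → let j , colj , maps = copies i in j , trans (sym (f≗g j)) colj , maps)
    (λ cs ¬copy → let col , agrees = extend S cs 0<r in
      ¬avoiding (col , λ mono → ¬copy (transfer cs col agrees mono)))
    ¬arrows
  where
  transfer : (cs : Fin ∣ S ∣ → Fin r) (col : Fin _ → Fin r) → (∀ i → col (enum S i) ≡ cs i) →
    MonoCopy E W S col H → Monochromatic (induced E W S) cs H
  transfer cs col agrees (c , f , inj , f∈W , copies) = c , f' , inj' , copies'
    where
    f' : Fin (nV H) → Fin ∣ W ∣
    f' x = proj₁ (enum-surjective W (f∈W x))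
    enum-f' : ∀ x → enum W (f' x) ≡ f x
    enum-f' x = proj₂ (enum-surjective W (f∈W x))
    inj' : Injective _≡_ _≡_ f'
    inj' {x} {y} eq = inj (trans (sym (enum-f' x)) (trans (cong (enum W) eq) (enum-f' y)))
    copies' : (i : Fin (nE H)) → Σ (Fin ∣ S ∣) λ j →
      (cs j ≡ c) × MapsOnto f' (edge H i) (preimage (enum W) (E (enum S j)))
    copies' i with copies i
    ... | j , j∈S , colj , maps with enum-surjective S j∈S
    ... | j' , refl = j' , trans (sym (agrees j')) colj , λ y →
      (λ y∈ → let x , x∈ , fx≡ = proj₁ (maps (enum W y)) (∈-preimage⁻ (enum W) y∈)
              in x , x∈ , enum-injective W (trans (enum-f' x) fx≡)) ,
      (λ (x , x∈ , f'x≡) → ∈-preimage⁺ (enum W)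
        (proj₂ (maps (enum W y)) (x , x∈ , trans (sym (enum-f' x)) (cong (enum W) f'x≡))))

-- Counting incidences.

-- Both sides count the pairs (i , j) with j in `A i`.
∑∣∣-comm : (A : Fin n → Subset m) →
  sum (λ i → ∣ A i ∣) ≡ sum (λ j → ∣ tabulate (λ i → lookup (A i) j) ∣)
∑∣∣-comm A = trans (sum-cong-≗ (λ i → ∣∣-sum (A i)))
  (trans (∑-comm (λ i j → ind (lookup (A i) j)))
    (sum-cong-≗ (λ j → sym (∣tabulate∣-sum (λ i → lookup (A i) j)))))
  where
  ind : _ → ℕ
  ind s = if s then 1 else 0
  ∣∣-sum : ∀ {n} (p : Subset n) → ∣ p ∣ ≡ sum (λ i → ind (lookup p i))
  ∣∣-sum [] = refl
  ∣∣-sum (true ∷ p) = cong suc (∣∣-sum p)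
  ∣∣-sum (false ∷ p) = ∣∣-sum p
  ∣tabulate∣-sum : ∀ {n} (f : Fin n → _) → ∣ tabulate f ∣ ≡ sum (λ i → ind (f i))
  ∣tabulate∣-sum f = trans (∣∣-sum (tabulate f)) (sum-cong-≗ (λ i → cong ind (lookup∘tabulate f i)))

sum-const : ∀ n (c : ℕ) (f : Fin n → ℕ) → (∀ i → f i ≡ c) → sum f ≡ n * c
sum-const zero c f eq = refl
sum-const (suc n) c f eq = cong₂ _+_ (eq zero) (sum-const n c (f ∘ suc) (eq ∘ suc))

∣p∣*c≤sum : (p : Subset n) (c : ℕ) (f : Fin n → ℕ) → (∀ {i} → i ∈ p → c ≤ f i) → ∣ p ∣ * c ≤ sum f
∣p∣*c≤sum [] c f h = z≤n
∣p∣*c≤sum (true ∷ p) c f h = +-mono-≤ (h here) (∣p∣*c≤sum p c (f ∘ suc) (h ∘ there))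
∣p∣*c≤sum (false ∷ p) c f h = ≤-trans (∣p∣*c≤sum p c (f ∘ suc) (h ∘ there)) (m≤n+m _ _)

-- Greedy colouring.

-- Pigeonhole: if every colour were hit, choosing preimages would inject `Fin t` into `Fin D`.
unused : ∀ {D t} → D < t → (g : Fin D → Fin t) → Σ (Fin t) λ c → ∀ x → g x ≢ c
unused {D} {t} D<t g =
  let c , ¬hit = Fin.¬∀⟶∃¬ t (λ c → Σ (Fin D) λ x → g x ≡ c) (λ c → Fin.any? (λ x → g x Fin.≟ c)) ¬surj
  in c , λ x gx≡c → ¬hit (x , gx≡c)
  where
  ¬surj : ¬ (∀ c → Σ (Fin D) λ x → g x ≡ c)
  ¬surj section = <⇒≱ D<t (Fin.injective⇒≤ {f = proj₁ ∘ section} λ {c} {c'} eq →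
    trans (sym (proj₂ (section c))) (trans (cong g eq) (proj₂ (section c'))))

greedyColouring : ∀ {n t} (R : Fin n → Fin n → Set) → 0 < t → (∀ {u v} → R u v → R v u) →
  (∀ {v} → ¬ R v v) →
  (∀ v → Σ ℕ λ D → D < t × Σ (Fin D → Fin n) λ nbr → ∀ {w} → R v w → Σ (Fin D) λ x → nbr x ≡ w) →
  Σ (Fin n → Fin t) λ χ → ∀ {u v} → R u v → χ u ≢ χ v
greedyColouring {n} {t} R 0<t R-sym R-irrefl cover =
  let χ , proper = upTo n ≤-refl in χ , λ {u} {v} → proper (Fin.toℕ<n u) (Fin.toℕ<n v)
  where
  -- Properness is claimed only among the first i vertices; later ones carry a placeholder colour.
  upTo : ∀ i → i ≤ n → Σ (Fin n → Fin t) λ χ →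
    ∀ {u v} → toℕ u < i → toℕ v < i → R u v → χ u ≢ χ v
  upTo zero _ = (λ _ → fromℕ< 0<t) , λ ()
  upTo (suc i) i<n with upTo i (<⇒≤ i<n)
  ... | χ , proper with cover (fromℕ< i<n)
  ... | D , D<t , nbr , covers with unused D<t (χ ∘ nbr)
  ... | c , free = χ' , proper'
    where
    v₀ = fromℕ< i<n
    choose : ∀ u → Dec (u ≡ v₀) → Fin t
    choose u (yes _) = c
    choose u (no _) = χ u
    χ' : Fin n → Fin t
    χ' u = choose u (u Fin.≟ v₀)
    below : ∀ {u} → toℕ u < suc i → u ≢ v₀ → toℕ u < i
    below u<1+i u≢v₀ = ≤∧≢⇒< (≤-pred u<1+i)
      (λ eq → u≢v₀ (Fin.toℕ-injective (trans eq (sym (Fin.toℕ-fromℕ< i<n)))))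
    fresh : ∀ {w} → R v₀ w → χ w ≢ c
    fresh Rvw with covers Rvw
    ... | x , refl = free x
    proper' : ∀ {u v} → toℕ u < suc i → toℕ v < suc i → R u v → χ' u ≢ χ' v
    proper' {u} {v} u< v< Ruv with u Fin.≟ v₀ | v Fin.≟ v₀
    ... | yes refl | yes refl = contradiction Ruv R-irrefl
    ... | yes refl | no _ = fresh Ruv ∘ sym
    ... | no _ | yes refl = fresh (R-sym Ruv)
    ... | no u≢ | no v≢ = proper (below u< u≢) (below v< v≢) Ruv

-- Vertex deletion and embeddings edge by edge.

∉-minus : (p : Subset n) (x : Fin n) → x ∉ p - x
∉-minus (_ ∷ p) zero ()
∉-minus (_ ∷ p) (suc x) (there x∈) = ∉-minus p x x∈

-- Both families share one index set; an embedding that selects edges is obtained by reindexing `B`.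
record EdgewiseEmbedding (A : Fin n → Subset a) (B : Fin n → Subset b) : Set where
  field
    vertex : Fin a → Fin b
    injective : Injective _≡_ _≡_ vertex
    into : ∀ i {x} → x ∈ A i → vertex x ∈ B i
    onto : ∀ i {z} → z ∈ B i → Σ (Fin a) λ x → x ∈ A i × vertex x ≡ z
open EdgewiseEmbedding

MapsOnto-∘ : {A : Fin n → Subset m} {B : Fin n → Subset a} {f : Fin a → Fin b} {e : Subset b}
  (emb : EdgewiseEmbedding A B) (i : Fin n) → MapsOnto f (B i) e → MapsOnto (f ∘ vertex emb) (A i) e
MapsOnto-∘ {f = f} emb i maps y =
  (λ y∈ → let z , z∈ , fz≡y = proj₁ (maps y) y∈
              x , x∈ , hx≡z = onto emb i z∈
          in x , x∈ , trans (cong f hx≡z) fz≡y) ,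
  (λ (x , x∈ , fhx≡y) → proj₂ (maps y) (vertex emb x , into emb i x∈ , fhx≡y))

MapsOnto-minus : {f : Fin a → Fin b} {e : Subset a} {e' : Subset b} (p : Fin a) →
  Injective _≡_ _≡_ f → MapsOnto f e e' → MapsOnto f (e - p) (e' - f p)
MapsOnto-minus {f = f} {e} {e'} p inj maps y = to , from
  where
  to : y ∈ e' - f p → _
  to y∈ with proj₁ (maps y) (p─q⊆p e' _ y∈)
  ... | x , x∈ , refl = x , x∈p∧x≢y⇒x∈p-y x∈ (λ { refl → ∉-minus e' (f p) y∈ }) , refl
  from : _ → y ∈ e' - f p
  from (x , x∈ , refl) = x∈p∧x≢y⇒x∈p-y (proj₂ (maps y) (x , p─q⊆p e _ x∈ , refl))
    (λ eq → ∉-minus e p (subst (_∈ e - p) (inj eq) x∈))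

-- Edges, links and subpaths of (k,ℓ)-paths.

∈-pathEdge⁺ : ∀ k ℓ m (i : Fin m) {x} → toℕ i * (k ∸ ℓ) ≤ toℕ x → toℕ x < toℕ i * (k ∸ ℓ) + k →
  x ∈ edge (pathEdges k ℓ m) i
∈-pathEdge⁺ k ℓ m i {x} lower upper = lookup⇒[]= x _ (trans (lookup∘tabulate _ x)
  (Equivalence.to T-≡ (Equivalence.from T-∧ (≤⇒≤ᵇ lower , <⇒<ᵇ upper))))

∈-pathEdge⁻ : ∀ k ℓ m (i : Fin m) {x} → x ∈ edge (pathEdges k ℓ m) i →
  toℕ i * (k ∸ ℓ) ≤ toℕ x × toℕ x < toℕ i * (k ∸ ℓ) + k
∈-pathEdge⁻ k ℓ m i {x} x∈ =
  let lower , upper = Equivalence.to T-∧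
        (Equivalence.from T-≡ (trans (sym (lookup∘tabulate _ x)) ([]=⇒lookup x∈)))
  in ≤ᵇ⇒≤ _ _ lower , <ᵇ⇒< _ _ upper

-- punchIn on natural numbers: the order embedding of ℕ into ℕ that misses p.
skip : ℕ → ℕ → ℕ
skip p y with y <? p
... | yes _ = y
... | no _ = suc y

skip-≤ : ∀ p y → skip p y ≤ suc y
skip-≤ p y with y <? p
... | yes _ = n≤1+n y
... | no _ = ≤-refl

skip-injective : ∀ p {y z} → skip p y ≡ skip p z → y ≡ z
skip-injective p {y} {z} eq with y <? p | z <? p
... | yes _ | yes _ = eq
... | yes y<p | no z≮p = contradiction (<-trans (n<1+n z) (subst (_< p) eq y<p)) z≮p
... | no y≮p | yes z<p = contradiction (<-trans (n<1+n y) (subst (_< p) (sym eq) z<p)) y≮p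
... | no _ | no _ = suc-injective eq

skip-≢ : ∀ p y → skip p y ≢ p
skip-≢ p y eq with y <? p
... | yes y<p = <⇒≢ y<p eq
... | no y≮p = y≮p (subst (y <_) eq (n<1+n y))

-- With `skip-surjective`: if lo ≤ p ≤ hi, then `skip p` maps [lo, hi) onto [lo, hi] without p. This
-- is how a path edge of k vertices loses p and becomes an interval of k - 1.
skip-interval : ∀ {p lo hi y} → p ≤ hi → lo ≤ y → y < hi → lo ≤ skip p y × skip p y < suc hi
skip-interval {p} {y = y} p≤hi lo≤y y<hi with y <? p
... | yes _ = lo≤y , m<n⇒m<1+n y<hi
... | no _ = m≤n⇒m≤1+n lo≤y , s≤s y<hi

skip-surjective : ∀ {p lo hi z} → lo ≤ p → p ≤ hi → z ≢ p → lo ≤ z → z < suc hi →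
  Σ ℕ λ y → skip p y ≡ z × lo ≤ y × y < hi
skip-surjective {p} {z = z} lo≤p p≤hi z≢p lo≤z z<1+hi with <-cmp z p
... | tri< z<p _ _ = z , skip-below , lo≤z , <-≤-trans z<p p≤hi
  where
  skip-below : skip p z ≡ z
  skip-below with z <? p
  ... | yes _ = refl
  ... | no z≮p = contradiction z<p z≮p
... | tri≈ _ z≡p _ = contradiction z≡p z≢p
skip-surjective {p} {z = suc y} lo≤p p≤hi z≢p lo≤z z<1+hi | tri> _ _ p<z =
  y , skip-above , ≤-trans lo≤p (≤-pred p<z) , ≤-pred z<1+hi
  where
  skip-above : skip p y ≡ suc y
  skip-above with y <? p
  ... | yes y<p = contradiction (≤-pred p<z) (<⇒≱ y<p)
  ... | no _ = refl

m<[1+m/n]*n : ∀ m n .{{_ : NonZero n}} → m < suc (m / n) * n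
m<[1+m/n]*n m n = subst (_< suc (m / n) * n) (sym (m≡m%n+[m/n]*n m n)) (+-monoˡ-< (m / n * n) (m%n<n m n))

-- The k / (k ∸ ℓ) consecutive edges through an inner vertex p of a (k,ℓ)-path, with p deleted, form
-- a (k-1,ℓ-1)-path.
link-embedding : ∀ k' ℓ' m → let k = suc k'; ℓ = suc ℓ'; d = k' ∸ ℓ' in .{{_ : NonZero d}} → ℓ' ≤ k' →
  (p : Fin (ℓ + m * d)) → k ≤ toℕ p → toℕ p + k ≤ ℓ + m * d →
  Σ (Fin (k / d) → Fin m) λ idx →
  (∀ x → p ∈ edge (pathEdges k ℓ m) (idx x)) ×
  EdgewiseEmbedding (edge (pathEdges k' ℓ' (k / d))) (λ x → edge (pathEdges k ℓ m) (idx x) - p)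
link-embedding k' ℓ' m ℓ'≤k' p k≤p p+k≤ =
  idx , p∈ , record { vertex = h ; injective = h-injective ; into = h-into ; onto = h-onto }
  where
  open ≤-Reasoning
  k = suc k'
  ℓ = suc ℓ'
  d = k' ∸ ℓ'
  M = k / d
  p̂ = toℕ p
  -- Edge `j` is the last to start at or before p. The `M` edges from `i₀` to `j` all contain p,
  -- because M * d ≤ k.
  j = p̂ / d
  i₀ = suc (j ∸ M)
  d+ℓ' : d + ℓ' ≡ k'
  d+ℓ' = m∸n+n≡m ℓ'≤k'
  i₀+M : i₀ + M ≡ suc j
  i₀+M = cong suc (m∸n+n≡m (/-monoˡ-≤ d k≤p))
  -- The distance of p from the right end guarantees that edge `j` exists, by d + ℓ = k.
  j<m : j < m
  j<m = *-cancelʳ-≤ (suc j) m d (+-cancelʳ-≤ ℓ (suc j * d) (m * d) (begin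
    d + j * d + ℓ   ≤⟨ +-monoˡ-≤ ℓ (+-monoʳ-≤ d (m/n*n≤m p̂ d)) ⟩
    d + p̂ + ℓ       ≡⟨ trans (+-assoc d p̂ ℓ) (trans (cong (d +_) (+-comm p̂ ℓ)) (sym (+-assoc d ℓ p̂))) ⟩
    d + ℓ + p̂       ≡⟨ cong (_+ p̂) (trans (+-suc d ℓ') (cong suc d+ℓ')) ⟩
    k + p̂           ≡⟨ +-comm k p̂ ⟩
    p̂ + k           ≤⟨ p+k≤ ⟩
    ℓ + m * d       ≡⟨ +-comm ℓ (m * d) ⟩
    m * d + ℓ       ∎))
  i₀+x≤j : (x : Fin M) → i₀ + toℕ x ≤ j
  i₀+x≤j x = ≤-pred (≤-trans (+-monoʳ-< i₀ (Fin.toℕ<n x)) (≤-reflexive i₀+M))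
  idx-bound : (x : Fin M) → i₀ + toℕ x < m
  idx-bound x = ≤-<-trans (i₀+x≤j x) j<m
  idx : Fin M → Fin m
  idx x = fromℕ< (idx-bound x)
  origin : Fin M → ℕ
  origin x = i₀ * d + toℕ x * d
  idx-origin : ∀ x → toℕ (idx x) * d ≡ origin x
  idx-origin x = trans (cong (_* d) (Fin.toℕ-fromℕ< (idx-bound x))) (*-distribʳ-+ d i₀ (toℕ x))
  origin≤p : ∀ x → origin x ≤ p̂
  origin≤p x = begin
    origin x           ≡⟨ *-distribʳ-+ d i₀ (toℕ x) ⟨
    (i₀ + toℕ x) * d  ≤⟨ *-monoˡ-≤ d (i₀+x≤j x) ⟩
    j * d             ≤⟨ m/n*n≤m p̂ d ⟩
    p̂                 ∎
  p<origin+k : ∀ x → p̂ < origin x + k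
  p<origin+k x = begin-strict
    p̂                 <⟨ m<[1+m/n]*n p̂ d ⟩
    suc j * d         ≡⟨ cong (_* d) i₀+M ⟨
    (i₀ + M) * d      ≡⟨ *-distribʳ-+ d i₀ M ⟩
    i₀ * d + M * d    ≤⟨ +-mono-≤ (m≤m+n (i₀ * d) (toℕ x * d)) (m/n*n≤m k d) ⟩
    origin x + k       ∎
  p≤origin+k' : ∀ x → p̂ ≤ origin x + k'
  p≤origin+k' x = ≤-pred (subst (p̂ <_) (+-suc (origin x) k') (p<origin+k x))
  p∈ : ∀ x → p ∈ edge (pathEdges k ℓ m) (idx x)
  p∈ x = ∈-pathEdge⁺ k ℓ m (idx x)
    (subst (_≤ p̂) (sym (idx-origin x)) (origin≤p x))
    (subst (λ s → p̂ < s + k) (sym (idx-origin x)) (p<origin+k x))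
  bound : (y : Fin (ℓ' + M * d)) → skip p̂ (i₀ * d + toℕ y) < ℓ + m * d
  bound y = begin-strict
    skip p̂ (i₀ * d + toℕ y)      ≤⟨ skip-≤ p̂ _ ⟩
    suc (i₀ * d + toℕ y)         <⟨ s≤s (+-monoʳ-< (i₀ * d) (Fin.toℕ<n y)) ⟩
    suc (i₀ * d + (ℓ' + M * d))  ≡⟨ cong suc (+-comm (i₀ * d) _) ⟩
    ℓ + M * d + i₀ * d           ≡⟨ +-assoc ℓ (M * d) (i₀ * d) ⟩
    ℓ + (M * d + i₀ * d)         ≡⟨ cong (ℓ +_) (*-distribʳ-+ d M i₀) ⟨
    ℓ + (M + i₀) * d             ≡⟨ cong (λ i → ℓ + i * d) (trans (+-comm M i₀) i₀+M) ⟩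
    ℓ + suc j * d                ≤⟨ +-monoʳ-≤ ℓ (*-monoˡ-≤ d j<m) ⟩
    ℓ + m * d                    ∎
  -- Shift to the start of edge `i₀`, then jump over p.
  h : Fin (ℓ' + M * d) → Fin (ℓ + m * d)
  h y = fromℕ< (bound y)
  toℕ-h : ∀ y → toℕ (h y) ≡ skip p̂ (i₀ * d + toℕ y)
  toℕ-h y = Fin.toℕ-fromℕ< (bound y)
  h-injective : Injective _≡_ _≡_ h
  h-injective {y} {z} eq = Fin.toℕ-injective (+-cancelˡ-≡ (i₀ * d) _ _
    (skip-injective p̂ (trans (sym (toℕ-h y)) (trans (cong toℕ eq) (toℕ-h z)))))
  h-into : ∀ x {y} → y ∈ edge (pathEdges k' ℓ' M) x → h y ∈ edge (pathEdges k ℓ m) (idx x) - p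
  h-into x {y} y∈ = x∈p∧x≢y⇒x∈p-y
    (∈-pathEdge⁺ k ℓ m (idx x)
      (subst₂ _≤_ (sym (idx-origin x)) (sym (toℕ-h y)) (proj₁ range))
      (subst₂ _<_ (sym (toℕ-h y))
        (trans (sym (+-suc (origin x) k')) (cong (_+ k) (sym (idx-origin x)))) (proj₂ range)))
    (λ hy≡p → skip-≢ p̂ (i₀ * d + toℕ y) (trans (sym (toℕ-h y)) (cong toℕ hy≡p)))
    where
    ends = ∈-pathEdge⁻ k' ℓ' M x y∈
    range : origin x ≤ skip p̂ (i₀ * d + toℕ y) × skip p̂ (i₀ * d + toℕ y) < suc (origin x + k')
    range = skip-interval (p≤origin+k' x) (+-monoʳ-≤ (i₀ * d) (proj₁ ends))
      (subst (i₀ * d + toℕ y <_) (sym (+-assoc (i₀ * d) (toℕ x * d) k')) (+-monoʳ-< (i₀ * d) (proj₂ ends)))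
  h-onto : ∀ x {z} → z ∈ edge (pathEdges k ℓ m) (idx x) - p →
    Σ (Fin (ℓ' + M * d)) λ y → y ∈ edge (pathEdges k' ℓ' M) x × h y ≡ z
  h-onto x {z} z∈ with ∈-pathEdge⁻ k ℓ m (idx x) (p─q⊆p _ _ z∈)
  ... | lower , upper with skip-surjective {lo = origin x} {hi = origin x + k'} (origin≤p x) (p≤origin+k' x)
          (λ z≡p → ∉-minus _ p (subst (_∈ edge (pathEdges k ℓ m) (idx x) - p) (Fin.toℕ-injective z≡p) z∈))
          (subst (_≤ toℕ z) (idx-origin x) lower)
          (subst (toℕ z <_) (trans (cong (_+ k) (idx-origin x)) (+-suc (origin x) k')) upper)
  ... | w , skip≡z , origin≤w , w<origin+k' =
    y , ∈-pathEdge⁺ k' ℓ' M x lower-y upper-y , Fin.toℕ-injective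
      (trans (toℕ-h y) (trans (cong (λ w → skip p̂ w) i₀d+y) skip≡z))
    where
    i₀d≤w : i₀ * d ≤ w
    i₀d≤w = ≤-trans (m≤m+n (i₀ * d) (toℕ x * d)) origin≤w
    w-i₀d : i₀ * d + (w ∸ i₀ * d) ≡ w
    w-i₀d = m+[n∸m]≡n i₀d≤w
    offset-upper : w ∸ i₀ * d < toℕ x * d + k'
    offset-upper = +-cancelˡ-< (i₀ * d) _ _
      (subst₂ _<_ (sym w-i₀d) (+-assoc (i₀ * d) (toℕ x * d) k') w<origin+k')
    offset-bound : w ∸ i₀ * d < ℓ' + M * d
    offset-bound = <-≤-trans offset-upper (begin
      toℕ x * d + k'        ≡⟨ cong (toℕ x * d +_) d+ℓ' ⟨
      toℕ x * d + (d + ℓ')  ≡⟨ +-assoc (toℕ x * d) d ℓ' ⟨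
      toℕ x * d + d + ℓ'    ≡⟨ cong (_+ ℓ') (+-comm (toℕ x * d) d) ⟩
      suc (toℕ x) * d + ℓ'  ≤⟨ +-monoˡ-≤ ℓ' (*-monoˡ-≤ d (Fin.toℕ<n x)) ⟩
      M * d + ℓ'            ≡⟨ +-comm (M * d) ℓ' ⟩
      ℓ' + M * d            ∎)
    y : Fin (ℓ' + M * d)
    y = fromℕ< offset-bound
    toℕ-y : toℕ y ≡ w ∸ i₀ * d
    toℕ-y = Fin.toℕ-fromℕ< offset-bound
    i₀d+y : i₀ * d + toℕ y ≡ w
    i₀d+y = trans (cong (i₀ * d +_) toℕ-y) w-i₀d
    lower-y : toℕ x * d ≤ toℕ y
    lower-y = +-cancelˡ-≤ (i₀ * d) _ _ (subst (origin x ≤_) (sym i₀d+y) origin≤w)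
    upper-y : toℕ y < toℕ x * d + k'
    upper-y = subst (_< toℕ x * d + k') (sym toℕ-y) offset-upper

-- Translation by j edge steps. The positions are returned so that the subpath can later be located
-- in the middle of the long path.
subpath-embedding : ∀ k ℓ m m' j → .{{_ : NonZero (k ∸ ℓ)}} →
  j * (k ∸ ℓ) + (ℓ + m' * (k ∸ ℓ)) ≤ ℓ + m * (k ∸ ℓ) → ℓ ≤ k →
  Σ (Fin m' → Fin m) λ idx →
  Σ (EdgewiseEmbedding (edge (pathEdges k ℓ m')) (λ i → edge (pathEdges k ℓ m) (idx i))) λ emb →
  ∀ x → toℕ (vertex emb x) ≡ j * (k ∸ ℓ) + toℕ x
subpath-embedding k ℓ m m' j fits ℓ≤k =
  idx , record { vertex = h ; injective = h-injective ; into = h-into ; onto = h-onto } , toℕ-h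
  where
  open ≤-Reasoning
  d = k ∸ ℓ
  j+m'≤m : j + m' ≤ m
  j+m'≤m = *-cancelʳ-≤ (j + m') m d (+-cancelˡ-≤ ℓ _ _ (begin
    ℓ + (j + m') * d        ≡⟨ cong (ℓ +_) (*-distribʳ-+ d j m') ⟩
    ℓ + (j * d + m' * d)    ≡⟨ +-assoc ℓ (j * d) (m' * d) ⟨
    ℓ + j * d + m' * d      ≡⟨ cong (_+ m' * d) (+-comm ℓ (j * d)) ⟩
    j * d + ℓ + m' * d      ≡⟨ +-assoc (j * d) ℓ (m' * d) ⟩
    j * d + (ℓ + m' * d)    ≤⟨ fits ⟩
    ℓ + m * d               ∎))
  idx-bound : (i : Fin m') → j + toℕ i < m
  idx-bound i = <-≤-trans (+-monoʳ-< j (Fin.toℕ<n i)) j+m'≤m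
  idx : Fin m' → Fin m
  idx i = fromℕ< (idx-bound i)
  idx-origin : ∀ i → toℕ (idx i) * d ≡ j * d + toℕ i * d
  idx-origin i = trans (cong (_* d) (Fin.toℕ-fromℕ< (idx-bound i))) (*-distribʳ-+ d j (toℕ i))
  idx-end : ∀ i → toℕ (idx i) * d + k ≡ j * d + (toℕ i * d + k)
  idx-end i = trans (cong (_+ k) (idx-origin i)) (+-assoc (j * d) (toℕ i * d) k)
  bound : (x : Fin (ℓ + m' * d)) → j * d + toℕ x < ℓ + m * d
  bound x = <-≤-trans (+-monoʳ-< (j * d) (Fin.toℕ<n x)) fits
  h : Fin (ℓ + m' * d) → Fin (ℓ + m * d)
  h x = fromℕ< (bound x)
  toℕ-h : ∀ x → toℕ (h x) ≡ j * d + toℕ x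
  toℕ-h x = Fin.toℕ-fromℕ< (bound x)
  h-injective : Injective _≡_ _≡_ h
  h-injective {x} {y} eq = Fin.toℕ-injective (+-cancelˡ-≡ (j * d) _ _
    (trans (sym (toℕ-h x)) (trans (cong toℕ eq) (toℕ-h y))))
  h-into : ∀ i {y} → y ∈ edge (pathEdges k ℓ m') i → h y ∈ edge (pathEdges k ℓ m) (idx i)
  h-into i {y} y∈ = let lower , upper = ∈-pathEdge⁻ k ℓ m' i y∈ in ∈-pathEdge⁺ k ℓ m (idx i)
    (subst₂ _≤_ (sym (idx-origin i)) (sym (toℕ-h y)) (+-monoʳ-≤ (j * d) lower))
    (subst₂ _<_ (sym (toℕ-h y)) (sym (idx-end i)) (+-monoʳ-< (j * d) upper))
  h-onto : ∀ i {z} → z ∈ edge (pathEdges k ℓ m) (idx i) →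
    Σ (Fin (ℓ + m' * d)) λ y → y ∈ edge (pathEdges k ℓ m') i × h y ≡ z
  h-onto i {z} z∈ = y , ∈-pathEdge⁺ k ℓ m' i
      (+-cancelˡ-≤ (j * d) _ _ (subst₂ _≤_ (idx-origin i) (sym jd+y) lower))
      (subst (_< toℕ i * d + k) (sym toℕ-y) offset-upper) ,
    Fin.toℕ-injective (trans (toℕ-h y) jd+y)
    where
    lower = proj₁ (∈-pathEdge⁻ k ℓ m (idx i) z∈)
    upper = proj₂ (∈-pathEdge⁻ k ℓ m (idx i) z∈)
    jd≤z : j * d ≤ toℕ z
    jd≤z = ≤-trans (m≤m+n (j * d) (toℕ i * d)) (subst (_≤ toℕ z) (idx-origin i) lower)
    z-jd : j * d + (toℕ z ∸ j * d) ≡ toℕ z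
    z-jd = m+[n∸m]≡n jd≤z
    offset-upper : toℕ z ∸ j * d < toℕ i * d + k
    offset-upper = +-cancelˡ-< (j * d) _ _ (subst₂ _<_ (sym z-jd) (idx-end i) upper)
    offset-bound : toℕ z ∸ j * d < ℓ + m' * d
    offset-bound = <-≤-trans offset-upper (begin
      toℕ i * d + k        ≡⟨ cong (toℕ i * d +_) (m∸n+n≡m ℓ≤k) ⟨
      toℕ i * d + (d + ℓ)  ≡⟨ +-assoc (toℕ i * d) d ℓ ⟨
      toℕ i * d + d + ℓ    ≡⟨ cong (_+ ℓ) (+-comm (toℕ i * d) d) ⟩
      suc (toℕ i) * d + ℓ  ≤⟨ +-monoˡ-≤ ℓ (*-monoˡ-≤ d (Fin.toℕ<n i)) ⟩
      m' * d + ℓ           ≡⟨ +-comm (m' * d) ℓ ⟩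
      ℓ + m' * d           ∎)
    y : Fin (ℓ + m' * d)
    y = fromℕ< offset-bound
    toℕ-y : toℕ y ≡ toℕ z ∸ j * d
    toℕ-y = Fin.toℕ-fromℕ< offset-bound
    jd+y : j * d + toℕ y ≡ toℕ z
    jd+y = trans (cong (j * d +_) toℕ-y) z-jd

-- Replaces the case distinction on `k ∸ ℓ` by plain division, to which the division lemmas apply.
numEdges-/ : ∀ k ℓ n .{{_ : NonZero (k ∸ ℓ)}} → numEdges k ℓ n ≡ (n ∸ ℓ) / (k ∸ ℓ)
numEdges-/ k ℓ n with k ∸ ℓ
... | suc d = refl

qVal-/ : ∀ k ℓ .{{_ : NonZero (k ∸ ℓ)}} → qVal k ℓ ≡ (ℓ ∸ 1) + (k / (k ∸ ℓ)) * (k ∸ ℓ)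
qVal-/ k ℓ with k ∸ ℓ
... | suc d = refl

-- Degrees, links and low vertices.

incident : (Fin a → Subset b) → Fin b → Subset a
incident E v = tabulate (λ e → lookup (E e) v)

∈-incident⁺ : (E : Fin a → Subset b) {v : Fin b} {e : Fin a} → v ∈ E e → e ∈ incident E v
∈-incident⁺ E {v} {e} v∈e =
  lookup⇒[]= e _ (trans (lookup∘tabulate (λ e → lookup (E e) v) e) ([]=⇒lookup v∈e))

∈-incident⁻ : (E : Fin a → Subset b) {v : Fin b} {e : Fin a} → e ∈ incident E v → v ∈ E e
∈-incident⁻ E {v} {e} e∈ =
  lookup⇒[]= v (E e) (trans (sym (lookup∘tabulate (λ e → lookup (E e) v) e)) ([]=⇒lookup e∈))

-- The vertex v stays as an isolated vertex. The number of edges is the degree of v, which is what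
-- gets compared with s₀.
link : (Fin a → Subset b) → Fin b → Hypergraph
link E v = induced (λ e → E e - v) ⊤ (incident E v)

minus-injective : {p q : Subset n} {x : Fin n} → x ∈ p → x ∈ q → p - x ≡ q - x → p ≡ q
minus-injective {x = x} x∈p x∈q eq = ⊆-antisym (incl x∈q eq) (incl x∈p (sym eq))
  where
  incl : {p q : Subset _} → x ∈ q → p - x ≡ q - x → p ⊆ q
  incl {q = q} x∈q eq {y} y∈p with y Fin.≟ x
  ... | yes refl = x∈q
  ... | no y≢x = p─q⊆p q _ (subst (y ∈_) eq (x∈p∧x≢y⇒x∈p-y y∈p y≢x))

link-IsKGraph : {k : ℕ} (G : Hypergraph) → IsKGraph (suc k) G → (v : Fin (nV G)) →
  IsKGraph k (link (edge G) v)
link-IsKGraph G (sizes , injective) v = induced-IsKGraph {E = λ e → edge G e - v} (λ _ _ → ∈⊤)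
  (λ {e} e∈ → suc-injective (trans (sym (∣p∣≡1+∣p-x∣ (edge G e) (∈-incident⁻ (edge G) e∈))) (sizes e)))
  (λ e∈ e'∈ eq → injective (minus-injective (∈-incident⁻ (edge G) e∈) (∈-incident⁻ (edge G) e'∈) eq))

within : (Fin a → Subset b) → Subset b → Subset a
within E W = separate (λ e → E e ⊆? W)

within-IsKGraph : {k : ℕ} (G : Hypergraph) → IsKGraph k G → (W : Subset (nV G)) →
  IsKGraph k (induced (edge G) W (within (edge G) W))
within-IsKGraph G (sizes , injective) W = induced-IsKGraph
  (λ e∈ → ∈-separate⁻ (λ e → edge G e ⊆? W) e∈) (λ {e} _ → sizes e) (λ _ _ → injective)

-- The degrees sum to k times the number of edges, and each vertex of `L` contributes at least c.
∣p∣*c≤edges*k : ∀ {k} (G : Hypergraph) → IsKGraph k G → (L : Subset (nV G)) (c : ℕ) →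
  (∀ {v} → v ∈ L → c ≤ ∣ incident (edge G) v ∣) → ∣ L ∣ * c ≤ nE G * k
∣p∣*c≤edges*k {k} G (sizes , _) L c high = ≤-trans
  (∣p∣*c≤sum L c (λ v → ∣ incident (edge G) v ∣) high)
  (≤-reflexive (trans (sym (∑∣∣-comm (edge G))) (sum-const (nE G) k (λ e → ∣ edge G e ∣) sizes)))

Adjacent : (G : Hypergraph) → Subset (nV G) → Fin (nV G) → Fin (nV G) → Set
Adjacent G L u v = u ∉ L × v ∉ L × u ≢ v × Σ (Fin (nE G)) λ e → u ∈ edge G e × v ∈ edge G e

-- A low vertex lies in fewer than s edges, each with k' other vertices, so fewer than s * k'
-- entries list its neighbours.
lowColouring : ∀ {k' s} (G : Hypergraph) → IsKGraph (suc k') G → (L : Subset (nV G)) →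
  0 < k' → 0 < s → (∀ {v} → v ∉ L → ∣ incident (edge G) v ∣ < s) →
  Σ (Fin (nV G) → Fin (s * k')) λ χ → ∀ {u v} → Adjacent G L u v → χ u ≢ χ v
lowColouring {k'} {s} G (sizes , _) L 0<k' 0<s low = greedyColouring (Adjacent G L)
  0<t
  (λ (u∉ , v∉ , u≢v , e , u∈ , v∈) → v∉ , u∉ , u≢v ∘ sym , e , v∈ , u∈)
  (λ (_ , _ , v≢v , _) → v≢v refl)
  cover
  where
  0<t : 0 < s * k'
  0<t = *-mono-≤ 0<s 0<k'
  cover : ∀ v → Σ ℕ λ D → D < s * k' × Σ (Fin D → Fin (nV G)) λ nbr →
    ∀ {w} → Adjacent G L v w → Σ (Fin D) λ x → nbr x ≡ w
  cover v with v ∈? L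
  ... | yes v∈L = 0 , 0<t , (λ ()) , λ (v∉ , _) → contradiction v∈L v∉
  ... | no v∉L = ∣ I ∣ * k' , *-monoˡ-< k' {{>-nonZero 0<k'}} (low v∉L) , nbr , covers
    where
    I = incident (edge G) v
    others : (i : Fin ∣ I ∣) → ∣ edge G (enum I i) - v ∣ ≡ k'
    others i = suc-injective (trans
      (sym (∣p∣≡1+∣p-x∣ (edge G (enum I i)) (∈-incident⁻ (edge G) (enum-∈ I i)))) (sizes _))
    member : Fin ∣ I ∣ × Fin k' → Fin (nV G)
    member (i , y) = enum (edge G (enum I i) - v) (cast (sym (others i)) y)
    nbr : Fin (∣ I ∣ * k') → Fin (nV G)
    nbr x = member (remQuot k' x)
    covers : ∀ {w} → Adjacent G L v w → Σ (Fin (∣ I ∣ * k')) λ x → nbr x ≡ w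
    covers {w} (_ , _ , v≢w , e , v∈e , w∈e) with enum-surjective I (∈-incident⁺ (edge G) v∈e)
    ... | i , refl with enum-surjective (edge G (enum I i) - v) (x∈p∧x≢y⇒x∈p-y w∈e (v≢w ∘ sym))
    ... | y , refl = combine i (cast (others i) y) ,
      trans (cong member (Fin.remQuot-combine i (cast (others i) y)))
        (cong (enum _) (Fin.cast-involutive (sym (others i)) (others i) y))

-- The combined colouring and its monochromatic paths.

module _
  (k' ℓ' : ℕ) .{{_ : NonZero (k' ∸ ℓ')}} (ℓ'≤k' : ℓ' ≤ k')
  (G : Hypergraph) (L : Subset (nV G))
  (linkColour : Fin (nV G) → Fin (nE G) → Fin r)
  (link-avoids : ∀ v → v ∉ L → ¬ MonoCopy (λ e → edge G e - v) ⊤ (incident (edge G) v) (linkColour v)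
    (pathEdges k' ℓ' (suc k' / (k' ∸ ℓ'))))
  (highColour : Fin (nE G) → Fin r) (m' : ℕ)
  (high-avoids : ¬ MonoCopy (edge G) L (within (edge G) L) highColour (pathEdges (suc k') (suc ℓ') m'))
  {t : ℕ} (χ : Fin (nV G) → Fin t) (proper : ∀ {u v} → Adjacent G L u v → χ u ≢ χ v)
  where

  private
    k = suc k'
    ℓ = suc ℓ'
    d = k' ∸ ℓ'

  Owner : Fin (nE G) → Fin (nV G) → Set
  Owner e v = v ∈ edge G e × v ∉ L × (∀ w → w ∈ edge G e → w ∉ L → toℕ (χ w) ≤ toℕ (χ v))

  owner? : ∀ e → Dec (∃ (Owner e))
  owner? e = Fin.any? λ v → (v ∈? edge G e) ×-dec ¬? (v ∈? L) ×-dec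
    Fin.all? λ w → (w ∈? edge G e) →-dec (¬? (w ∈? L) →-dec (toℕ (χ w) ≤? toℕ (χ v)))

  -- Pass to a low vertex of `e` with larger χ as long as there is one; h bounds the number of such
  -- passes.
  owner-exists : ∀ h {e v} → v ∈ edge G e → v ∉ L → t ≤ toℕ (χ v) + h → ∃ (Owner e)
  owner-exists zero {v = v} _ _ t≤ =
    contradiction (Fin.toℕ<n (χ v)) (≤⇒≯ (subst (t ≤_) (+-identityʳ _) t≤))
  owner-exists (suc h) {e} {v} v∈e v∉L t≤
    with Fin.any? (λ w → (w ∈? edge G e) ×-dec ¬? (w ∈? L) ×-dec (toℕ (χ v) <? toℕ (χ w)))
  ... | yes (w , w∈e , w∉L , χv<χw) = owner-exists h w∈e w∉L
    (≤-trans t≤ (≤-trans (≤-reflexive (+-suc _ h)) (+-monoˡ-≤ h χv<χw)))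
  ... | no maximal = v , v∈e , v∉L , λ w w∈e w∉L → ≮⇒≥ λ χv<χw → maximal (w , w∈e , w∉L , χv<χw)

  colourBy : ∀ e → Dec (∃ (Owner e)) → Fin r
  colourBy e (yes (v , _)) = linkColour v e
  colourBy e (no _) = highColour e

  colour : Fin (nE G) → Fin r
  colour e = colourBy e (owner? e)

  -- If v owned `e`, then `e` would have the link colour of v. So the owner is another low vertex,
  -- and properness makes its χ strictly larger.
  higher-exists : ∀ {e v} → v ∈ edge G e → v ∉ L → colour e ≢ linkColour v e →
    Σ (Fin (nV G)) λ w → w ∈ edge G e × w ∉ L × toℕ (χ v) < toℕ (χ w)
  higher-exists {e} {v} v∈e v∉L ≢link with owner? e
  ... | no ¬owner = contradiction (owner-exists t v∈e v∉L (m≤n+m t _)) ¬owner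
  ... | yes (w , w∈e , w∉L , maximal) = w , w∈e , w∉L , ≤∧≢⇒< (maximal v v∈e v∉L)
    λ χv≡χw → proper (v∉L , w∉L , (λ { refl → ≢link refl }) , e , v∈e , w∈e) (Fin.toℕ-injective χv≡χw)

  colour-within : ∀ {e} → edge G e ⊆ L → colour e ≡ highColour e
  colour-within {e} e⊆L with owner? e
  ... | no _ = refl
  ... | yes (v , v∈e , v∉L , _) = contradiction (e⊆L v∈e) v∉L

  module _ {m : ℕ} (mono : Monochromatic G colour (pathEdges k ℓ m)) where
    private
      c = proj₁ mono
      f = proj₁ (proj₂ mono)
      f-injective = proj₁ (proj₂ (proj₂ mono))
      copies = proj₂ (proj₂ (proj₂ mono))
      len = ℓ + m * d

    -- If every path edge idx x had the link colour of f p, the link of f p would contain a forbidden path.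
    higher-nearby-via : (p : Fin len) → f p ∉ L → (idx : Fin (k / d) → Fin m) →
      (∀ x → p ∈ edge (pathEdges k ℓ m) (idx x)) →
      EdgewiseEmbedding (edge (pathEdges k' ℓ' (k / d))) (λ x → edge (pathEdges k ℓ m) (idx x) - p) →
      Σ (Fin len) λ q → f q ∉ L × toℕ (χ (f p)) < toℕ (χ (f q)) × toℕ p < toℕ q + k × toℕ q < toℕ p + k
    higher-nearby-via p fp∉L idx p∈ emb
      with Fin.all? (λ x → let e = proj₁ (copies (idx x)) in colour e Fin.≟ linkColour (f p) e)
    ... | yes linked = ⊥-elim (link-avoids (f p) fp∉L
      (c , f ∘ vertex emb , (λ eq → injective emb (f-injective eq)) , (λ _ → ∈⊤) , λ x →
        let e , coloured , maps = copies (idx x)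
        in e , ∈-incident⁺ (edge G) (proj₂ (maps (f p)) (p , p∈ x , refl)) ,
           trans (sym (linked x)) coloured ,
           MapsOnto-∘ emb x (MapsOnto-minus p f-injective maps)))
    ... | no ¬linked
      with Fin.¬∀⟶∃¬ _ _
             (λ x → let e = proj₁ (copies (idx x)) in colour e Fin.≟ linkColour (f p) e) ¬linked
    ... | x , ≢link with copies (idx x)
    ... | e , _ , maps
      with higher-exists (proj₂ (maps (f p)) (p , p∈ x , refl)) fp∉L ≢link
    ... | w , w∈e , w∉L , χ< with proj₁ (maps w) w∈e
    ... | q , q∈ , refl = q , w∉L , χ< , near (p∈ x) q∈ , near q∈ (p∈ x)
      where
      near : ∀ {u v} → u ∈ edge (pathEdges k ℓ m) (idx x) → v ∈ edge (pathEdges k ℓ m) (idx x) →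
        toℕ u < toℕ v + k
      near u∈ v∈ = <-≤-trans (proj₂ (∈-pathEdge⁻ k ℓ m (idx x) u∈))
        (+-monoˡ-≤ k (proj₁ (∈-pathEdge⁻ k ℓ m (idx x) v∈)))

    higher-nearby : (p : Fin len) → f p ∉ L → k ≤ toℕ p → toℕ p + k ≤ len →
      Σ (Fin len) λ q → f q ∉ L × toℕ (χ (f p)) < toℕ (χ (f q)) × toℕ p < toℕ q + k × toℕ q < toℕ p + k
    higher-nearby p fp∉L k≤p p+k≤ =
      let idx , p∈ , emb = link-embedding k' ℓ' m ℓ'≤k' p k≤p p+k≤
      in higher-nearby-via p fp∉L idx p∈ emb

    -- Induction on h, a bound on how often χ can still increase. Each step to a higher low vertex
    -- moves fewer than k positions, and the chain can only stop within k of an end.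
    low-near-ends : ∀ h (p : Fin len) → f p ∉ L → t ≤ toℕ (χ (f p)) + h →
      toℕ p < h * k ⊎ len ≤ toℕ p + h * k
    low-near-ends zero p _ t≤ =
      contradiction (Fin.toℕ<n (χ (f p))) (≤⇒≯ (subst (t ≤_) (+-identityʳ _) t≤))
    low-near-ends (suc h) p fp∉L t≤ with k ≤? toℕ p | toℕ p + k ≤? len
    ... | no k≰p | _ = inj₁ (<-≤-trans (≰⇒> k≰p) (m≤m+n k (h * k)))
    ... | yes _ | no p+k≰ = inj₂ (≤-trans (<⇒≤ (≰⇒> p+k≰)) (+-monoʳ-≤ (toℕ p) (m≤m+n k (h * k))))
    ... | yes k≤p | yes p+k≤ =
      let q , fq∉L , χ< , p<q+k , q<p+k = higher-nearby p fp∉L k≤p p+k≤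
      in Sum.map
        (λ q<hk → <-trans p<q+k (subst (toℕ q + k <_) (+-comm (h * k) k) (+-monoˡ-< k q<hk)))
        (λ len≤ → ≤-trans len≤ (≤-trans (+-monoˡ-≤ (h * k) (<⇒≤ q<p+k))
          (≤-reflexive (+-assoc (toℕ p) k (h * k)))))
        (low-near-ends h q fq∉L (≤-trans t≤ (≤-trans (≤-reflexive (+-suc _ h)) (+-monoˡ-≤ h χ<))))

    middle-high : (p : Fin len) → t * k ≤ toℕ p → toℕ p + t * k < len → f p ∈ L
    middle-high p tk≤p p+tk< = decidable-stable (f p ∈? L) λ fp∉L →
      case low-near-ends t p fp∉L (m≤n+m t _) of λ where
        (inj₁ p<tk) → <⇒≱ p<tk tk≤p
        (inj₂ len≤) → <⇒≱ p+tk< len≤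

  -- The subpath starting at position j * d keeps t * k vertices away from both ends, hence lies in
  -- `L`. Its edges have their `highColour`, contradicting `high-avoids`.
  colour-avoids : ∀ {m} j → t * k ≤ j * d → j * d + (ℓ + m' * d) + t * k ≤ ℓ + m * d →
    ¬ Monochromatic G colour (pathEdges k ℓ m)
  colour-avoids {m} j tk≤jd fits mono@(c , f , f-injective , copies) =
    let idx , emb , toℕ-emb = subpath-embedding k ℓ m m' j (≤-trans (m≤m+n _ (t * k)) fits) (s≤s ℓ'≤k')
    in high-avoids (highCopy idx emb toℕ-emb)
    where
    highCopy : (idx : Fin m' → Fin m)
      (emb : EdgewiseEmbedding (edge (pathEdges k ℓ m')) (λ i → edge (pathEdges k ℓ m) (idx i))) →
      (∀ x → toℕ (vertex emb x) ≡ j * d + toℕ x) →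
      MonoCopy (edge G) L (within (edge G) L) highColour (pathEdges k ℓ m')
    highCopy idx emb toℕ-emb = c , f ∘ vertex emb , (λ eq → injective emb (f-injective eq)) , high , λ i →
      let e , coloured , maps = copies (idx i)
          maps′ = MapsOnto-∘ emb i maps
          e⊆L = λ {v} v∈e → let x , _ , fx≡v = proj₁ (maps′ v) v∈e in subst (_∈ L) fx≡v (high x)
      in e , ∈-separate⁺ (λ e → edge G e ⊆? L) e⊆L , trans (sym (colour-within e⊆L)) coloured , maps′
      where
      high : ∀ x → f (vertex emb x) ∈ L
      high x = middle-high mono (vertex emb x)
        (subst (t * k ≤_) (sym (toℕ-emb x)) (≤-trans tk≤jd (m≤m+n (j * d) (toℕ x))))
        (<-≤-trans (+-monoˡ-< (t * k) (subst (_< j * d + (ℓ + m' * d)) (sym (toℕ-emb x))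
          (+-monoʳ-< (j * d) (Fin.toℕ<n x)))) fits)

-- c₀ = 2 k² s₀ leaves room for two end segments of s₀ (k-1) k vertices, one for each
-- step of an increasing chain of colours, and for rounding up to an edge boundary.
ends-fit : ∀ k' s → 0 < s → suc k' + (s * k' * suc k' + s * k' * suc k') ≤ 2 * suc k' * suc k' * s
-- The two sides differ by k + 2 (s - 1) k; adding this on the left leaves an identity for the ring
-- solver.
ends-fit k' s@(suc s') _ = subst (suc k' + (s * k' * suc k' + s * k' * suc k') ≤_)
  (identity k' s') (m≤m+n _ _)
  where
  identity : ∀ k' s' → suc k' + (suc s' * k' * suc k' + suc s' * k' * suc k') + (suc k' + 2 * s' * suc k')
    ≡ 2 * suc k' * suc k' * suc s'
  identity = solve-∀

-- Choice of constants and conclusion.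

theorem1p2 : (r k ℓ : ℕ) → 2 ≤ r → 2 ≤ k → 1 ≤ ℓ → ℓ < k →
    (s₀ : ℕ) → IsSizeRamseyNumber r (k ∸ 1) (P (qVal k ℓ) (k ∸ 1) (ℓ ∸ 1)) s₀ →
    (n : ℕ) → 2 * k * k * s₀ ≤ n → (k ∸ ℓ) ∣ (n ∸ ℓ) →
    (s N : ℕ) → IsSizeRamseyNumber r k (P n k ℓ) s →
    IsRamseyNumber r k (P (n ∸ 2 * k * k * s₀) k ℓ) N →
    s₀ * N ≤ k * s
theorem1p2 r (suc k') (suc ℓ') 2≤r (s≤s 0<k') _ (s≤s ℓ'<k') s₀ (_ , s₀-minimal) n c₀≤n d∣n-ℓ _ N
  ((G , G-k , G-arrows , refl) , _) (_ , N-minimal) =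
  decidable-stable (s₀ * N ≤? k * nE G) λ large →
    ¬¬-∀-Fin link-colouring λ linkColouring →
    high-colouring large λ (highColour , high-avoids) →
    -- For s₀ = 0 the bound is trivial, against `large`.
    let 0<s₀ = n≢0⇒n>0 λ { refl → large z≤n }
        χ , proper = lowColouring G G-k L 0<k' 0<s₀ low
    in colour-avoids k' ℓ' ℓ'≤k' G L (proj₁ ∘ linkColouring) (proj₂ ∘ linkColouring) highColour edges'
         high-avoids χ proper j tk≤jd (fits 0<s₀) (G-arrows _)
  where
  open ≤-Reasoning
  k = suc k'
  ℓ = suc ℓ'
  d = k' ∸ ℓ'
  ℓ'≤k' = <⇒≤ ℓ'<k'
  instance
    d≢0 : NonZero d
    d≢0 = >-nonZero (m<n⇒0<n∸m ℓ'<k')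
  c₀ = 2 * k * k * s₀
  edges = numEdges k ℓ n
  edges' = numEdges k ℓ (n ∸ c₀)
  t = s₀ * k'
  -- Rounds the end segment of t * k vertices up to an edge boundary, adding at most d vertices.
  j = suc (t * k / d)
  0<r = <⇒≤ 2≤r
  high? : (v : Fin (nV G)) → Dec (s₀ ≤ ∣ incident (edge G) v ∣)
  high? v = s₀ ≤? ∣ incident (edge G) v ∣
  L : Subset (nV G)
  L = separate high?
  low : ∀ {v} → v ∉ L → ∣ incident (edge G) v ∣ < s₀
  low v∉L = ≰⇒> λ s₀≤ → v∉L (∈-separate⁺ high? s₀≤)
  linkPath = pathEdges k' ℓ' (k / d)
  -- The value q gives the path exactly k / d edges, as many as `link-embedding` finds through an
  -- inner vertex.
  P-q≡linkPath : P (qVal k ℓ) k' ℓ' ≡ linkPath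
  P-q≡linkPath = cong (pathEdges k' ℓ') (begin-equality
    numEdges k' ℓ' (qVal k ℓ)         ≡⟨ numEdges-/ k' ℓ' (qVal k ℓ) ⟩
    (qVal k ℓ ∸ ℓ') / d               ≡⟨ cong (λ q → (q ∸ ℓ') / d) (qVal-/ k ℓ) ⟩
    (ℓ' + k / d * d ∸ ℓ') / d         ≡⟨ cong (_/ d) (m+n∸m≡n ℓ' (k / d * d)) ⟩
    k / d * d / d                     ≡⟨ m*n/n≡m (k / d) d ⟩
    k / d                             ∎)
  link-colouring : ∀ v → ¬ ¬ (Σ (Fin (nE G) → Fin r) λ col →
    v ∉ L → ¬ MonoCopy (λ e → edge G e - v) ⊤ (incident (edge G) v) col linkPath)
  link-colouring v with v ∈? L
  -- Nothing is asked at high vertices; a constant colouring serves there.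
  ... | yes v∈L = λ k → k ((λ _ → fromℕ< 0<r) , contradiction v∈L)
  ... | no v∉L = ¬¬-map (λ (col , avoids) → col , λ _ → avoids)
    (¬Arrows⇒avoiding (λ e → edge G e - v) ⊤ (incident (edge G) v) linkPath 0<r λ arrows →
      -- The link has fewer than s₀ edges, so arrowing would contradict the minimality of s₀.
      <⇒≱ (low v∉L) (s₀-minimal (link (edge G) v) (link-IsKGraph G G-k v)
        (subst (Arrows (link (edge G) v) r) (sym P-q≡linkPath) arrows)))
  high-colouring : ¬ s₀ * N ≤ k * nE G → ¬ ¬ (Σ (Fin (nE G) → Fin r) λ col →
    ¬ MonoCopy (edge G) L (within (edge G) L) col (pathEdges k ℓ edges'))
  high-colouring large = ¬Arrows⇒avoiding (edge G) L (within (edge G) L) _ 0<r λ arrows →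
    -- If G[L] arrowed the shorter path, then N ≤ |L|, and the incidence count would give the bound.
    large (begin
      s₀ * N         ≤⟨ *-monoʳ-≤ s₀ (N-minimal _ (within-IsKGraph G G-k L) arrows) ⟩
      s₀ * ∣ L ∣     ≡⟨ *-comm s₀ ∣ L ∣ ⟩
      ∣ L ∣ * s₀     ≤⟨ ∣p∣*c≤edges*k G G-k L s₀ (∈-separate⁻ high?) ⟩
      nE G * k       ≡⟨ *-comm (nE G) k ⟩
      k * nE G       ∎)
  tk≤jd : t * k ≤ j * d
  tk≤jd = <⇒≤ (m<[1+m/n]*n (t * k) d)
  fits : 0 < s₀ → j * d + (ℓ + edges' * d) + t * k ≤ ℓ + edges * d
  fits 0<s₀ = begin
    d + q * d + (ℓ + edges' * d) + t * k                 ≤⟨ +-monoˡ-≤ (t * k) (+-mono-≤ (+-monoʳ-≤ d (m/n*n≤m (t * k) d)) (+-monoʳ-≤ ℓ edges'*d≤)) ⟩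
    d + t * k + (ℓ + (n ∸ c₀)) + t * k               ≡⟨ rearrange d (t * k) ℓ (n ∸ c₀) ⟩
    d + ℓ + (t * k + t * k) + (n ∸ c₀)               ≡⟨ cong (λ x → x + (t * k + t * k) + (n ∸ c₀)) (m∸n+n≡m (s≤s ℓ'≤k')) ⟩
    k + (t * k + t * k) + (n ∸ c₀)                   ≤⟨ +-monoˡ-≤ (n ∸ c₀) ends≤c₀ ⟩
    c₀ + (n ∸ c₀)                                    ≡⟨ m+[n∸m]≡n c₀≤n ⟩
    n                                                ≡⟨ m+[n∸m]≡n ℓ≤n ⟨
    -- By divisibility the path has exactly n vertices.
    ℓ + (n ∸ ℓ)                                      ≡⟨ cong (ℓ +_) (m/n*n≡m d∣n-ℓ) ⟨
    ℓ + (n ∸ ℓ) / d * d                              ≡⟨ cong (λ x → ℓ + x * d) (numEdges-/ k ℓ n) ⟨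
    ℓ + edges * d                                        ∎
    where
    q = t * k / d
    ends≤c₀ : k + (t * k + t * k) ≤ c₀
    ends≤c₀ = ends-fit k' s₀ 0<s₀
    ℓ≤n : ℓ ≤ n
    ℓ≤n = ≤-trans (s≤s ℓ'≤k') (≤-trans (m≤m+n k _) (≤-trans ends≤c₀ c₀≤n))
    -- Giving away ℓ here covers the truncated case n - c₀ < ℓ as well.
    edges'*d≤ : edges' * d ≤ n ∸ c₀
    edges'*d≤ = begin
      edges' * d                   ≡⟨ cong (_* d) (numEdges-/ k ℓ (n ∸ c₀)) ⟩
      (n ∸ c₀ ∸ ℓ) / d * d     ≤⟨ m/n*n≤m (n ∸ c₀ ∸ ℓ) d ⟩
      n ∸ c₀ ∸ ℓ               ≤⟨ m∸n≤m (n ∸ c₀) ℓ ⟩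
      n ∸ c₀                   ∎
    rearrange : ∀ d x ℓ y → d + x + (ℓ + y) + x ≡ d + ℓ + (x + x) + y
    rearrange = solve-∀
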